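{- For every planar graph $H$ there is a constant $c(H)$ such that every graph $G$ with $\operatorname{box}(G)\ge c(H)$ has a minor isomorphic to $H$.
   Context: The boxicity $\operatorname{box}(G)$ is the minimum $b$ such that $G$ is the intersection graph of axis-parallel boxes in $\mathbb{R}^b$ (products of $b$ closed intervals), one box per vertex. A minor of $G$ is a graph obtained from a subgraph of $G$ by contracting edges. -}

module Defs where

open import Level using (0ℓ)
open import Data.Nat.Base as ℕ using (ℕ; suc)
open import Data.Fin.Base as Fin using (Fin; punchIn)
open import Data.Fin.Properties using () renaming (_≟_ to _≟ᶠ_)
open import Data.Rational as ℚ using (ℚ; 0ℚ; 1ℚ)
open import Data.Rational.Properties as ℚP using ()
open import Data.Product using (Σ-syntax; ∃-syntax; _×_; _,_)
open import Data.Sum using (_⊎_; inj₁; inj₂)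
open import Function.Base using (_∘_)
open import Function.Bundles using (_⇔_; _↔_; module Inverse)
open import Function.Definitions using (Injective)
open import Relation.Binary.Core using (Rel)
open import Relation.Binary.Definitions using (Symmetric; Irreflexive; Decidable)
open import Relation.Binary.PropositionalEquality using (_≡_; _≢_; sym; cong; subst)
open import Relation.Nullary using (¬_)
open import Relation.Nullary.Decidable using (¬?; _×-dec_; _⊎-dec_)

Eventually : (ℕ → Set) → Set
Eventually P = ∃[ N ] (∀ n → N ℕ.≤ n → P n)

-- Cauchy sequences of rationals, equality being _≈_.
record ℝ : Set where
  field
    seq    : ℕ → ℚ
    cauchy : ∀ ε → 0ℚ ℚ.< ε →
             ∃[ N ] (∀ m n → N ℕ.≤ m → N ℕ.≤ n → ℚ.∣ seq m ℚ.- seq n ∣ ℚ.≤ ε)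

open ℝ public

infix 4 _≤ᴿ_ _<ᴿ_ _≈_

_≤ᴿ_ : Rel ℝ 0ℓ
x ≤ᴿ y = ∀ ε → 0ℚ ℚ.< ε → Eventually (λ n → seq x n ℚ.≤ seq y n ℚ.+ ε)

_<ᴿ_ : Rel ℝ 0ℓ
x <ᴿ y = ∃[ ε ] (0ℚ ℚ.< ε × Eventually (λ n → seq x n ℚ.+ ε ℚ.≤ seq y n))

_≈_ : Rel ℝ 0ℓ
x ≈ y = x ≤ᴿ y × y ≤ᴿ x

-- |x - y| < ε.  The intermediate rational δ makes this independent of the
-- sequences chosen to represent x and y.
Dist< : ℚ → Rel ℝ 0ℓ
Dist< ε x y = ∃[ δ ] (δ ℚ.< ε × Eventually (λ n → ℚ.∣ seq x n ℚ.- seq y n ∣ ℚ.≤ δ))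

fromℚ : ℚ → ℝ
fromℚ q .seq _ = q
fromℚ q .cauchy ε 0<ε = 0 , λ _ _ _ _ →
  subst (ℚ._≤ ε) (sym (cong ℚ.∣_∣ (ℚP.+-inverseʳ q))) (ℚP.<⇒≤ 0<ε)

0ᴿ 1ᴿ : ℝ
0ᴿ = fromℚ 0ℚ
1ᴿ = fromℚ 1ℚ

record Graph (n : ℕ) : Set₁ where
  field
    _~_      : Rel (Fin n) 0ℓ
    ~-sym    : Symmetric _~_
    ~-irrefl : Irreflexive _≡_ _~_
    _~?_     : Decidable _~_

Adj : ∀ {n} → Graph n → Rel (Fin n) 0ℓ
Adj = Graph._~_

_≅_ : ∀ {m n} → Graph m → Graph n → Set
_≅_ {m} {n} G H = Σ[ f ∈ Fin m ↔ Fin n ]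
  (∀ u v → Adj G u v ⇔ Adj H (Inverse.to f u) (Inverse.to f v))

-- S is, up to the naming of its vertices, a (not necessarily induced) subgraph of G.
_IsSubgraphOf_ : ∀ {m n} → Graph m → Graph n → Set
_IsSubgraphOf_ {m} {n} S G = Σ[ f ∈ (Fin m → Fin n) ]
  (Injective _≡_ _≡_ f × (∀ {u v} → Adj S u v → Adj G (f u) (f v)))

-- G / uv: the vertex v is removed (punchIn v enumerates the remaining vertices) and
-- u, standing for the contracted edge, inherits the neighbours of v.
-- Loops and parallel edges are discarded.
contract : ∀ {n} (G : Graph (suc n)) (u v : Fin (suc n)) → Adj G u v → Graph n
contract {n} G u v _ = record
  { _~_      = λ a b → a ≢ b × Joined (punchIn v a) (punchIn v b)
  ; ~-sym    = λ (a≢b , j) → (a≢b ∘ sym) , joined-sym j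
  ; ~-irrefl = λ a≡b (a≢b , _) → a≢b a≡b
  ; _~?_     = λ a b → ¬? (a ≟ᶠ b) ×-dec joined? (punchIn v a) (punchIn v b)
  }
  where
  open Graph G
  Joined : Rel (Fin (suc n)) 0ℓ
  Joined x y = x ~ y ⊎ ((x ≡ u × v ~ y) ⊎ (y ≡ u × v ~ x))

  joined-sym : Symmetric Joined
  joined-sym (inj₁ x~y)      = inj₁ (~-sym x~y)
  joined-sym (inj₂ (inj₁ p)) = inj₂ (inj₂ p)
  joined-sym (inj₂ (inj₂ p)) = inj₂ (inj₁ p)

  joined? : Decidable Joined
  joined? x y = (x ~? y) ⊎-dec
    (((x ≟ᶠ u) ×-dec (v ~? y)) ⊎-dec ((y ≟ᶠ u) ×-dec (v ~? x)))

data _ContractsTo_ : ∀ {m n} → Graph m → Graph n → Set₁ where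
  done : ∀ {n} {G : Graph n} → G ContractsTo G
  step : ∀ {m n} {G : Graph (suc m)} {K : Graph n} (u v : Fin (suc m)) (e : Adj G u v) →
         contract G u v e ContractsTo K → G ContractsTo K

_IsMinorOf_ : ∀ {m n} → Graph m → Graph n → Set₁
H IsMinorOf G =
  ∃[ s ] Σ[ S ∈ Graph s ] (S IsSubgraphOf G ×
  (∃[ k ] Σ[ K ∈ Graph k ] (S ContractsTo K × K ≅ H)))

Point : ℕ → Set
Point b = Fin b → ℝ

record Box (b : ℕ) : Set where
  field
    lower upper : Point b
    lower≤upper : ∀ i → lower i ≤ᴿ upper i

_∈ᴮ_ : ∀ {b} → Point b → Box b → Set
p ∈ᴮ B = ∀ i → Box.lower B i ≤ᴿ p i × p i ≤ᴿ Box.upper B i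

Intersect : ∀ {b} → Rel (Box b) 0ℓ
Intersect B C = ∃[ p ] (p ∈ᴮ B × p ∈ᴮ C)

BoxRepresentation : ∀ {n} → Graph n → ℕ → Set
BoxRepresentation {n} G b = Σ[ box ∈ (Fin n → Box b) ]
  (∀ u v → u ≢ v → Adj G u v ⇔ Intersect (box u) (box v))

-- box(G) = b
IsBoxicity : ∀ {n} → Graph n → ℕ → Set
IsBoxicity G b = BoxRepresentation G b × (∀ b′ → BoxRepresentation G b′ → b ℕ.≤ b′)

ℝ² : Set
ℝ² = ℝ × ℝ

infix 4 _≈²_

_≈²_ : Rel ℝ² 0ℓ
(x , y) ≈² (x′ , y′) = x ≈ x′ × y ≈ y′

-- Distance in the maximum norm.
Dist²< : ℚ → Rel ℝ² 0ℓ
Dist²< ε (x , y) (x′ , y′) = Dist< ε x x′ × Dist< ε y y′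

[0,1] : ℝ → Set
[0,1] t = 0ᴿ ≤ᴿ t × t ≤ᴿ 1ᴿ

⟨0,1⟩ : ℝ → Set
⟨0,1⟩ t = 0ᴿ <ᴿ t × t <ᴿ 1ᴿ

-- A simple curve parametrised by [0,1]; values of γ outside [0,1] are irrelevant.
-- Continuity implies that γ respects _≈_ on [0,1].
record IsSimpleArc (γ : ℝ → ℝ²) : Set where
  field
    continuous : ∀ t → [0,1] t → ∀ ε → 0ℚ ℚ.< ε →
                 ∃[ δ ] (0ℚ ℚ.< δ ×
                 (∀ s → [0,1] s → Dist< δ s t → Dist²< ε (γ s) (γ t)))
    injective  : ∀ s t → [0,1] s → [0,1] t → γ s ≈² γ t → s ≈ t

-- Each edge is listed once, with its ends in increasing order.
record Edge {n} (G : Graph n) : Set where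
  field
    end₁ end₂ : Fin n
    ordered   : end₁ Fin.< end₂
    adjacent  : Adj G end₁ end₂

open Edge public

SameEnds : ∀ {n} {G : Graph n} → Rel (Edge G) 0ℓ
SameEnds e f = end₁ e ≡ end₁ f × end₂ e ≡ end₂ f

record PlaneEmbedding {n} (G : Graph n) : Set where
  field
    point          : Fin n → ℝ²
    point-distinct : ∀ u v → point u ≈² point v → u ≡ v
    arc            : Edge G → ℝ → ℝ²
    arc-simple     : ∀ e → IsSimpleArc (arc e)
    arc-start      : ∀ e → arc e 0ᴿ ≈² point (end₁ e)
    arc-end        : ∀ e → arc e 1ᴿ ≈² point (end₂ e)
    arc-vertex     : ∀ e t w → ⟨0,1⟩ t → ¬ (arc e t ≈² point w)
    arc-arc        : ∀ e f s t → ¬ SameEnds e f → ⟨0,1⟩ s → ⟨0,1⟩ t →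
                     ¬ (arc e s ≈² arc f t)

Planar : ∀ {n} → Graph n → Set
Planar = PlaneEmbedding

{-# OPTIONS --safe #-}

-- Every graph G either has H as a minor or has a partition of its vertices into connected bags
-- (van den Heuvel et al.), chosen one after the other.  In a component C of the vertices not yet
-- covered, the earlier bags adjacent to C are pairwise adjacent; if there are at least h = |V(H)|
-- of them they contract to a complete graph on h vertices, which contains H.  Otherwise the
-- next bag is the union of at most h paths of a breadth-first search tree of C, from its
-- root to vertices adjacent to each of these earlier bags, so that the new bag is adjacent to
-- all of them.  Each path meets a distance layer at most once, so (distance mod 3, path) tells
-- apart vertices of the bag within distance two in C; together with a greedy colouring of the
-- bags this is a star colouring of G with a number of colours depending on h only.  Finally, any
-- two colour classes of a star colouring induce a star forest, which is an interval graph, and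
-- the intersection of these interval graphs over all pairs of colours is G.

module Submission where

open import Data.Fin.Base using (Fin; zero; suc; toℕ; combine; remQuot; punchIn; punchOut; inject≤)
open import Data.Fin.Properties as Finₚ using (toℕ<n; toℕ-injective; any?; combine-injective; remQuot-combine; punchIn-punchOut; punchOut-punchIn; inject≤-injective) renaming (_≟_ to _≟ᶠ_)
open import Data.Fin.Subset using (Subset; _⊂_; _⊃_) renaming (_∈_ to _∈ˢ_)
open import Data.Fin.Subset.Induction using (⊃-wellFounded; ⊂-wellFounded; Acc; acc)
open import Data.List.Base using (List; []; _∷_; _++_; length; lookup; map; filter; concatMap; allFin; upTo)
open import Data.List.Membership.Propositional using (_∈_)
open import Data.List.Membership.Propositional.Properties using (∈-lookup; ∈-filter⁺; ∈-filter⁻; ∈-allFin; ∈-upTo⁺; ∈-upTo⁻; ∈-map⁺; ∈-++⁺ˡ; ∈-++⁺ʳ; ∈-concatMap⁺)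
open import Data.List.Properties using (length-map; length-++)
open import Data.List.Relation.Unary.All as All using ()
open import Data.List.Relation.Unary.AllPairs using (_∷_)
open import Data.List.Relation.Unary.Any as Any using (index)
open import Data.List.Relation.Unary.Any.Properties using (lookup-index)
open import Data.List.Relation.Unary.Unique.Propositional using (Unique)
open import Data.List.Relation.Unary.Unique.Propositional.Properties using (allFin⁺; filter⁺; upTo⁺)
open import Data.Nat.Base using (ℕ; zero; suc; _+_; _*_; _∸_; _⊔_; _≤_; _<_; z≤n; s≤s)
open import Data.Nat.Properties as ℕₚ using ()
open import Data.Product using (Σ-syntax; ∃-syntax; _×_; _,_; proj₁; proj₂; uncurry)
open import Data.Rational as ℚ using (ℚ; 0ℚ; 1ℚ)
open import Data.Rational.Properties as ℚₚ using ()
open import Data.Sum using (_⊎_; inj₁; inj₂; [_,_]′)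
open import Data.Vec.Base using (tabulate)
open import Data.Vec.Properties using (lookup∘tabulate; []=⇒lookup; lookup⇒[]=)
open import Function.Base using (_∘_)
open import Function.Bundles using (_⇔_; mk⇔; mk↔ₛ′; Equivalence)
open import Function.Definitions using (Injective)
open import Relation.Binary.Construct.Closure.ReflexiveTransitive as Star using (Star; ε; _◅_; _◅◅_; kleisliStar)
open import Relation.Binary.Definitions using (tri<; tri≈; tri>)
open import Relation.Binary.PropositionalEquality using (_≡_; _≢_; refl; sym; trans; cong; cong₂; subst; subst₂; module ≡-Reasoning)
open import Relation.Nullary using (¬_; Dec; yes; no; contradiction)
open import Relation.Nullary.Decidable using (does; dec-true; decidable-stable; from-yes; from-no; ¬?; _×-dec_; _⊎-dec_)
open import Defs

-- Boxes from intervals with natural endpoints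

fromℕ : ℕ → ℚ
fromℕ zero    = 0ℚ
fromℕ (suc k) = fromℕ k ℚ.+ 1ℚ

p≤p+q : ∀ {q} p → 0ℚ ℚ.≤ q → p ℚ.≤ p ℚ.+ q
p≤p+q p 0≤q = subst (ℚ._≤ p ℚ.+ _) (ℚₚ.+-identityʳ p) (ℚₚ.+-monoʳ-≤ p 0≤q)

fromℕ-mono : ∀ {k l} → k ≤ l → fromℕ k ℚ.≤ fromℕ l
fromℕ-mono {l = zero}  z≤n       = ℚₚ.≤-refl
fromℕ-mono {l = suc l} z≤n       = ℚₚ.≤-trans (fromℕ-mono {l = l} z≤n) (p≤p+q (fromℕ l) (from-yes (0ℚ ℚ.≤? 1ℚ)))
fromℕ-mono             (s≤s k≤l) = ℚₚ.+-mono-≤ (fromℕ-mono k≤l) ℚₚ.≤-refl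

fromℚ-mono : ∀ {p q} → p ℚ.≤ q → fromℚ p ≤ᴿ fromℚ q
fromℚ-mono {q = q} p≤q δ 0<δ = 0 , λ _ _ → ℚₚ.≤-trans p≤q (p≤p+q q (ℚₚ.<⇒≤ 0<δ))

real : ℕ → ℝ
real k = fromℚ (fromℕ k)

-- If `k` exceeded `l`, it would do so by at least 1, while the two inequalities at precision 1/4,
-- read at a common late index, put `k` at most 1/2 above `l`.
real-sandwich : ∀ {k l} x → real k ≤ᴿ x → x ≤ᴿ real l → k ≤ l
real-sandwich {k} {l} x k≤x x≤l with k ℕₚ.≤? l
... | yes k≤l = k≤l
... | no  k≰l = contradiction 1≤½ (from-no (1ℚ ℚ.≤? ¼ ℚ.+ ¼))
  where
  ¼ : ℚ
  ¼ = ℚ.½ ℚ.* ℚ.½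
  0<¼ : 0ℚ ℚ.< ¼
  0<¼ = from-yes (0ℚ ℚ.<? ¼)
  M₁ M₂ N : ℕ
  M₁ = proj₁ (k≤x ¼ 0<¼)
  M₂ = proj₁ (x≤l ¼ 0<¼)
  N  = M₁ ⊔ M₂
  l+1≤l+½ : fromℕ l ℚ.+ 1ℚ ℚ.≤ fromℕ l ℚ.+ (¼ ℚ.+ ¼)
  l+1≤l+½ = begin
    fromℕ (suc l)            ≤⟨ fromℕ-mono (ℕₚ.≰⇒> k≰l) ⟩
    fromℕ k                  ≤⟨ proj₂ (k≤x ¼ 0<¼) N (ℕₚ.m≤m⊔n M₁ M₂) ⟩
    seq x N ℚ.+ ¼            ≤⟨ ℚₚ.+-monoˡ-≤ ¼ (proj₂ (x≤l ¼ 0<¼) N (ℕₚ.m≤n⊔m M₁ M₂)) ⟩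
    fromℕ l ℚ.+ ¼ ℚ.+ ¼      ≡⟨ ℚₚ.+-assoc (fromℕ l) ¼ ¼ ⟩
    fromℕ l ℚ.+ (¼ ℚ.+ ¼)    ∎
    where open ℚₚ.≤-Reasoning
  cancel : ∀ q → ℚ.- fromℕ l ℚ.+ (fromℕ l ℚ.+ q) ≡ q
  cancel q = trans (sym (ℚₚ.+-assoc (ℚ.- fromℕ l) (fromℕ l) q))
    (trans (cong (ℚ._+ q) (ℚₚ.+-inverseˡ (fromℕ l))) (ℚₚ.+-identityˡ q))
  1≤½ : 1ℚ ℚ.≤ ¼ ℚ.+ ¼
  1≤½ = subst (ℚ._≤ ¼ ℚ.+ ¼) (cancel 1ℚ)
    (subst (ℚ.- fromℕ l ℚ.+ (fromℕ l ℚ.+ 1ℚ) ℚ.≤_) (cancel (¼ ℚ.+ ¼)) (ℚₚ.+-monoʳ-≤ (ℚ.- fromℕ l) l+1≤l+½))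

Overlap : ℕ × ℕ → ℕ × ℕ → Set
Overlap (l , u) (l′ , u′) = l ≤ u′ × l′ ≤ u

boxRepresentation : ∀ {n b} (G : Graph n) (I : Fin b → Fin n → ℕ × ℕ) →
  (∀ i v → proj₁ (I i v) ≤ proj₂ (I i v)) →
  (∀ u v → u ≢ v → Adj G u v ⇔ (∀ i → Overlap (I i u) (I i v))) →
  BoxRepresentation G b
boxRepresentation {n} {b} G I lo≤hi I-rep = box , λ u v u≢v → mk⇔
  (λ e → meet u v (Equivalence.to (I-rep u v u≢v) e))
  (λ (p , p∈u , p∈v) → Equivalence.from (I-rep u v u≢v) λ i →
    real-sandwich (p i) (proj₁ (p∈u i)) (proj₂ (p∈v i)) ,
    real-sandwich (p i) (proj₁ (p∈v i)) (proj₂ (p∈u i)))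
  where
  box : Fin n → Box b
  box v = record
    { lower       = λ i → real (proj₁ (I i v))
    ; upper       = λ i → real (proj₂ (I i v))
    ; lower≤upper = λ i → fromℚ-mono (fromℕ-mono (lo≤hi i v))
    }
  meet : ∀ u v → (∀ i → Overlap (I i u) (I i v)) → Intersect (box u) (box v)
  -- In each coordinate the larger of the two lower ends is a common point.
  meet u v o = (λ i → real (proj₁ (I i u) ⊔ proj₁ (I i v))) ,
    (λ i → ≤ᴿ _ _ (ℕₚ.m≤m⊔n (proj₁ (I i u)) _) , ≤ᴿ _ _ (ℕₚ.⊔-lub (lo≤hi i u) (proj₂ (o i)))) ,
    (λ i → ≤ᴿ _ _ (ℕₚ.m≤n⊔m (proj₁ (I i u)) _) , ≤ᴿ _ _ (ℕₚ.⊔-lub (proj₁ (o i)) (lo≤hi i v)))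
    where
    ≤ᴿ : ∀ k l → k ≤ l → real k ≤ᴿ real l
    ≤ᴿ _ _ = fromℚ-mono ∘ fromℕ-mono

-- Star colourings and interval graphs

-- In the subgraph induced by two colour classes every component is a star, whose centre has
-- the smallest key.
record StarColouring {n} (G : Graph n) (k : ℕ) : Set where
  open Graph G
  field
    colour        : Fin n → Fin k
    key           : Fin n → ℕ
    key-injective : ∀ {u v} → key u ≡ key v → u ≡ v
    proper        : ∀ {u v} → u ~ v → colour u ≢ colour v
    centre        : ∀ {w x w′} → w ~ x → x ~ w′ → w ≢ w′ → colour w ≡ colour w′ → key x < key w

module StarIntervals {n k : ℕ} (G : Graph n) (S : StarColouring G k) where
  open Graph G
  open StarColouring S

  InClasses : Fin k → Fin k → Fin n → Set
  InClasses a b v = colour v ≡ a ⊎ colour v ≡ b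

  -- For a leaf `v` this is the centre of its star: the centre has the smallest key, hence is the
  -- only neighbour of `v` in the two classes with a smaller key.
  Root : Fin k → Fin k → Fin n → Fin n → Set
  Root a b v r = r ~ v × InClasses a b r × key r < key v

  -- A vertex without neighbours in the two classes counts as a hub without leaves.
  data Kind (a b : Fin k) (v : Fin n) : Set where
    outside : ¬ InClasses a b v → Kind a b v
    leaf    : InClasses a b v → ∀ r → Root a b v r → Kind a b v
    hub     : InClasses a b v → (∀ r → ¬ Root a b v r) → Kind a b v

  inClasses? : ∀ a b v → Dec (InClasses a b v)
  inClasses? a b v = (colour v ≟ᶠ a) ⊎-dec (colour v ≟ᶠ b)

  kind : ∀ a b v → Kind a b v
  kind a b v with inClasses? a b v
  ... | no  ∉ab = outside ∉ab
  ... | yes ∈ab with any? (λ r → (r ~? v) ×-dec (inClasses? a b r ×-dec (key r ℕₚ.<? key v)))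
  ...   | yes (r , root) = leaf ∈ab r root
  ...   | no  ¬root      = hub ∈ab (λ r root → ¬root (r , root))

  -- The stars occupy disjoint blocks of length 1 + n; leaves are distinct points of the block
  -- of their centre.
  interval : ∀ {a b v} → Kind a b v → ℕ × ℕ
  interval         (outside _)  = 0 , n * suc n
  interval {v = v} (leaf _ r _) = toℕ r * suc n + toℕ v , toℕ r * suc n + toℕ v
  interval {v = v} (hub _ _)    = toℕ v * suc n + 0 , toℕ v * suc n + n

  interval-proper : ∀ {a b v} (κ : Kind a b v) → proj₁ (interval κ) ≤ proj₂ (interval κ)
  interval-proper         (outside _)  = z≤n
  interval-proper         (leaf _ _ _) = ℕₚ.≤-refl
  interval-proper {v = v} (hub _ _)    = ℕₚ.+-monoʳ-≤ (toℕ v * suc n) z≤n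

  in-block : ∀ (r : Fin n) {s} → s ≤ n → toℕ r * suc n + s ≤ n * suc n
  in-block r {s} s≤n = begin
    toℕ r * suc n + s      ≤⟨ ℕₚ.+-monoʳ-≤ (toℕ r * suc n) (ℕₚ.m≤n⇒m≤1+n s≤n) ⟩
    toℕ r * suc n + suc n  ≡⟨ ℕₚ.+-comm (toℕ r * suc n) (suc n) ⟩
    suc (toℕ r) * suc n    ≤⟨ ℕₚ.*-monoˡ-≤ (suc n) (toℕ<n r) ⟩
    n * suc n              ∎
    where open ℕₚ.≤-Reasoning

  -- An offset `t` of at most `n` cannot reach the next block, as blocks have length `suc n`.
  block-≤ : ∀ q r {s t} → t ≤ n → q * suc n + s ≤ r * suc n + t → q ≤ r
  block-≤ q r {s} {t} t≤n le = ℕₚ.≤-pred (ℕₚ.*-cancelʳ-< (suc n) q (suc r) (begin-strict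
    q * suc n          ≤⟨ ℕₚ.m≤m+n (q * suc n) s ⟩
    q * suc n + s      ≤⟨ le ⟩
    r * suc n + t      <⟨ ℕₚ.+-monoʳ-< (r * suc n) (s≤s t≤n) ⟩
    r * suc n + suc n  ≡⟨ ℕₚ.+-comm (r * suc n) (suc n) ⟩
    suc r * suc n      ∎))
    where open ℕₚ.≤-Reasoning

  same-block : ∀ (q r : Fin n) {s t s′ t′} → t ≤ n → t′ ≤ n →
    toℕ q * suc n + s ≤ toℕ r * suc n + t → toℕ r * suc n + s′ ≤ toℕ q * suc n + t′ → q ≡ r
  same-block q r t≤n t′≤n le ge =
    toℕ-injective (ℕₚ.≤-antisym (block-≤ (toℕ q) (toℕ r) t≤n le) (block-≤ (toℕ r) (toℕ q) t′≤n ge))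

  toℕ≤n : (v : Fin n) → toℕ v ≤ n
  toℕ≤n v = ℕₚ.<⇒≤ (toℕ<n v)

  third-colour : ∀ {a b x y z} → InClasses a b x → InClasses a b y → InClasses a b z →
    colour x ≢ colour z → colour y ≢ colour z → colour x ≡ colour y
  third-colour (inj₁ p) (inj₁ q) _        _   _   = trans p (sym q)
  third-colour (inj₂ p) (inj₂ q) _        _   _   = trans p (sym q)
  third-colour (inj₁ p) (inj₂ q) (inj₁ r) x≢z _   = contradiction (trans p (sym r)) x≢z
  third-colour (inj₁ p) (inj₂ q) (inj₂ r) _   y≢z = contradiction (trans q (sym r)) y≢z
  third-colour (inj₂ p) (inj₁ q) (inj₁ r) _   y≢z = contradiction (trans q (sym r)) y≢z
  third-colour (inj₂ p) (inj₁ q) (inj₂ r) x≢z _   = contradiction (trans p (sym r)) x≢z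

  -- Two different roots would have the same colour, and `centre` on the path through `v` would make
  -- `key v` smaller than `key r`.
  root-unique : ∀ {a b v r s} → InClasses a b v → Root a b v r → Root a b v s → r ≡ s
  root-unique {v = v} {r} {s} ∈v (r~v , ∈r , r<v) (s~v , ∈s , s<v) with r ≟ᶠ s
  ... | yes r≡s = r≡s
  ... | no  r≢s = contradiction
    (centre r~v (~-sym s~v) r≢s (third-colour ∈r ∈s ∈v (proper r~v) (proper s~v)))
    (ℕₚ.<⇒≯ r<v)

  -- A root `r` of `u` would be one end of a path through `u` to `v` whose ends have the same
  -- colour, so `centre` would make `key u` smaller than `key r`.
  root-is-hub : ∀ {a b u v r} → InClasses a b v → Root a b v u → ¬ Root a b u r
  root-is-hub ∈v (u~v , ∈u , u<v) (r~u , ∈r , r<u) = ℕₚ.<⇒≯ r<u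
    -- `r` and `v` differ because `key r < key u < key v`.
    (centre r~u u~v (λ { refl → ℕₚ.<⇒≯ r<u u<v })
      (third-colour ∈r ∈v ∈u (proper r~u) (proper (~-sym u~v))))

  overlap-root : ∀ {a b u v} → InClasses a b u → InClasses a b v → Root a b v u →
    (κ : Kind a b u) (μ : Kind a b v) → Overlap (interval κ) (interval μ)
  overlap-root ∈u ∈v root (outside ∉u)     _               = contradiction ∈u ∉u
  overlap-root ∈u ∈v root _                (outside ∉v)    = contradiction ∈v ∉v
  overlap-root ∈u ∈v root (leaf _ r root′) _               = contradiction root′ (root-is-hub ∈v root)
  overlap-root ∈u ∈v root (hub _ _)        (hub _ ¬root)   = contradiction root (¬root _)
  overlap-root {u = u} {v} ∈u ∈v root (hub _ _) (leaf _ r root′)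
    with refl ← root-unique ∈v root root′ =
    ℕₚ.+-monoʳ-≤ (toℕ u * suc n) z≤n , ℕₚ.+-monoʳ-≤ (toℕ u * suc n) (toℕ≤n v)

  swap-overlap : ∀ {I J} → Overlap I J → Overlap J I
  swap-overlap (p , q) = q , p

  -- The long interval covers every block, so this pair of colours puts no constraint on a vertex of
  -- another colour.
  overlap-outside : ∀ {a b u v} (∉u : ¬ InClasses a b u) (μ : Kind a b v) →
    Overlap (interval (outside {v = u} ∉u)) (interval μ)
  overlap-outside         _ (outside _)  = z≤n , z≤n
  overlap-outside {v = v} _ (leaf _ r _) = z≤n , in-block r (toℕ≤n v)
  overlap-outside {v = v} _ (hub _ _)    = z≤n , in-block v z≤n

  overlap-classes : ∀ {a b u v} → InClasses a b u → InClasses a b v → u ~ v →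
    (κ : Kind a b u) (μ : Kind a b v) → Overlap (interval κ) (interval μ)
  overlap-classes {u = u} {v} ∈u ∈v u~v κ μ with ℕₚ.<-cmp (key u) (key v)
  ... | tri< u<v _ _ = overlap-root ∈u ∈v (u~v , ∈u , u<v) κ μ
  ... | tri> _ _ v<u = swap-overlap {interval μ} {interval κ}
                         (overlap-root ∈v ∈u (~-sym u~v , ∈v , v<u) μ κ)
  ... | tri≈ _ u≡v _ = contradiction u~v (~-irrefl (key-injective u≡v))

  overlaps : ∀ {a b u v} → u ~ v → (κ : Kind a b u) (μ : Kind a b v) → Overlap (interval κ) (interval μ)
  overlaps u~v (outside ∉u)      μ                  = overlap-outside ∉u μ
  overlaps u~v κ@(leaf _ _ _)    (outside ∉v)       = swap-overlap {J = interval κ} (overlap-outside ∉v κ)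
  overlaps u~v κ@(hub _ _)       (outside ∉v)       = swap-overlap {J = interval κ} (overlap-outside ∉v κ)
  overlaps u~v κ@(leaf ∈u _ _)   μ@(leaf ∈v _ _)    = overlap-classes ∈u ∈v u~v κ μ
  overlaps u~v κ@(leaf ∈u _ _)   μ@(hub ∈v _)       = overlap-classes ∈u ∈v u~v κ μ
  overlaps u~v κ@(hub ∈u _)      μ@(leaf ∈v _ _)    = overlap-classes ∈u ∈v u~v κ μ
  overlaps u~v κ@(hub ∈u _)      μ@(hub ∈v _)       = overlap-classes ∈u ∈v u~v κ μ

  -- Overlapping intervals lie in one block. Distinct hubs own distinct blocks and the leaves of a
  -- block are distinct points, so only a hub and one of its leaves remain.
  overlap⇒~ : ∀ {a b u v} → u ≢ v → InClasses a b u → InClasses a b v →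
    (κ : Kind a b u) (μ : Kind a b v) → Overlap (interval κ) (interval μ) → u ~ v
  overlap⇒~ u≢v ∈u ∈v (outside ∉u) _            _ = contradiction ∈u ∉u
  overlap⇒~ u≢v ∈u ∈v _            (outside ∉v) _ = contradiction ∈v ∉v
  overlap⇒~ {u = u} {v} u≢v ∈u ∈v (hub _ _) (hub _ _) (p , q) =
    contradiction (same-block u v ℕₚ.≤-refl ℕₚ.≤-refl p q) u≢v
  overlap⇒~ {u = u} {v} u≢v ∈u ∈v (hub _ _) (leaf _ r (r~v , _)) (p , q) =
    subst (_~ v) (sym (same-block u r (toℕ≤n v) ℕₚ.≤-refl p q)) r~v
  overlap⇒~ {u = u} {v} u≢v ∈u ∈v (leaf _ r (r~u , _)) (hub _ _) (p , q) =
    subst (u ~_) (same-block r v ℕₚ.≤-refl (toℕ≤n u) p q) (~-sym r~u)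
  overlap⇒~ {u = u} {v} u≢v ∈u ∈v (leaf _ r _) (leaf _ s _) (p , q)
    with refl ← same-block r s (toℕ≤n v) (toℕ≤n u) p q =
    contradiction (toℕ-injective (ℕₚ.+-cancelˡ-≡ (toℕ r * suc n) _ _ (ℕₚ.≤-antisym p q))) u≢v

  starBoxes : BoxRepresentation G (k * k)
  starBoxes = boxRepresentation G
    (λ i v → at (remQuot k i) v)
    (λ i v → interval-proper (uncurry kind (remQuot k i) v))
    λ u v u≢v → mk⇔
      (λ u~v i → overlaps u~v (uncurry kind (remQuot k i) u) (uncurry kind (remQuot k i) v))
      -- Nonadjacent `u` and `v` are separated in the coordinate of their own two colours, which may
      -- be equal.
      (λ o → overlap⇒~ u≢v (inj₁ refl) (inj₂ refl)
        (kind (colour u) (colour v) u) (kind (colour u) (colour v) v)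
        (subst (λ ab → Overlap (at ab u) (at ab v)) (remQuot-combine (colour u) (colour v))
          (o (combine (colour u) (colour v)))))
    where
    at : Fin k × Fin k → Fin n → ℕ × ℕ
    at (a , b) v = interval (kind a b v)

-- Contracting connected classes

-- `H` as the quotient of `S` by connected classes. `preserves` rules out further edges between
-- classes, so that contraction yields `H` itself and not a graph with more edges.
record ContractionMap {s h} (S : Graph s) (H : Graph h) : Set where
  open Graph S
  field
    label      : Fin s → Fin h
    surjective : ∀ p → ∃[ x ] label x ≡ p
    connected  : ∀ x y → label x ≡ label y → Star (λ a b → a ~ b × label a ≡ label b) x y
    preserves  : ∀ {x y} → x ~ y → label x ≢ label y → Adj H (label x) (label y)
    covers     : ∀ {p q} → Adj H p q → ∃[ x ] ∃[ y ] (label x ≡ p × label y ≡ q × x ~ y)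

module ContractEdge {m h : ℕ} (S : Graph (suc m)) (H : Graph h) (M : ContractionMap S H)
  (u v : Fin (suc m)) (u~v : Adj S u v) (u≈v : ContractionMap.label M u ≡ ContractionMap.label M v) where
  open Graph S
  open ContractionMap M

  S/uv : Graph m
  S/uv = contract S u v u~v

  v≢u : v ≢ u
  v≢u v≡u = ~-irrefl (sym v≡u) u~v

  -- The vertex map onto the contracted graph; `punchOut v≢u` is the new name of `u`.
  quotient : Fin (suc m) → Fin m
  quotient x with v ≟ᶠ x
  ... | yes _   = punchOut v≢u
  ... | no  v≢x = punchOut v≢x

  label′ : Fin m → Fin h
  label′ a = label (punchIn v a)

  label′-quotient : ∀ x → label′ (quotient x) ≡ label x
  label′-quotient x with v ≟ᶠ x
  ... | yes refl = trans (cong label (punchIn-punchOut v≢u)) u≈v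
  ... | no  v≢x  = cong label (punchIn-punchOut v≢x)

  quotient-punchIn : ∀ a → quotient (punchIn v a) ≡ a
  quotient-punchIn a with v ≟ᶠ punchIn v a
  ... | yes v≡ = contradiction (sym v≡) (Finₚ.punchInᵢ≢i v a)
  ... | no  _  = punchOut-punchIn v

  quotient-~ : ∀ {x y} → x ~ y → quotient x ≢ quotient y → Adj S/uv (quotient x) (quotient y)
  quotient-~ {x} {y} x~y x≉y = x≉y , joined
    where
    joined : punchIn v (quotient x) ~ punchIn v (quotient y) ⊎
      ((punchIn v (quotient x) ≡ u × v ~ punchIn v (quotient y)) ⊎
       (punchIn v (quotient y) ≡ u × v ~ punchIn v (quotient x)))
    joined with v ≟ᶠ x | v ≟ᶠ y
    ... | yes v≡x  | yes v≡y  = contradiction x~y (~-irrefl (trans (sym v≡x) v≡y))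
    ... | yes refl | no v≢y   =
      inj₂ (inj₁ (punchIn-punchOut v≢u , subst (v ~_) (sym (punchIn-punchOut v≢y)) x~y))
    ... | no v≢x   | yes refl =
      inj₂ (inj₂ (punchIn-punchOut v≢u , subst (v ~_) (sym (punchIn-punchOut v≢x)) (~-sym x~y)))
    ... | no v≢x   | no v≢y   =
      inj₁ (subst₂ _~_ (sym (punchIn-punchOut v≢x)) (sym (punchIn-punchOut v≢y)) x~y)

  -- A step along the contracted edge becomes the empty walk.
  quotient-step : ∀ {x y} → x ~ y × label x ≡ label y →
    Star (λ a b → Adj S/uv a b × label′ a ≡ label′ b) (quotient x) (quotient y)
  quotient-step {x} {y} (x~y , x≈y) with quotient x ≟ᶠ quotient y
  ... | yes eq rewrite eq = ε
  ... | no  ≉ =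
    (quotient-~ x~y ≉ , trans (label′-quotient x) (trans x≈y (sym (label′-quotient y)))) ◅ ε

  quotientMap : ContractionMap S/uv H
  quotientMap = record
    { label      = label′
    ; surjective = λ p → let x , x≈p = surjective p in quotient x , trans (label′-quotient x) x≈p
    ; connected  = λ a b a≈b → subst₂ (Star _) (quotient-punchIn a) (quotient-punchIn b)
        (kleisliStar quotient quotient-step (connected (punchIn v a) (punchIn v b) a≈b))
    ; preserves  = preserves′
    ; covers     = covers′
    }
    where
    preserves′ : ∀ {a b} → Adj S/uv a b → label′ a ≢ label′ b → Adj H (label′ a) (label′ b)
    preserves′ (_ , inj₁ a~b) a≉b = preserves a~b a≉b
    preserves′ {a} {b} (_ , inj₂ (inj₁ (a≡u , v~b))) a≉b =
      subst (λ p → Adj H p (label′ b)) (sym a≈v) (preserves v~b (a≉b ∘ trans a≈v))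
      where
      a≈v : label′ a ≡ label v
      a≈v = trans (cong label a≡u) u≈v
    preserves′ {a} {b} (_ , inj₂ (inj₂ (b≡u , v~a))) a≉b =
      Graph.~-sym H (subst (λ p → Adj H p (label′ a)) (sym b≈v) (preserves v~a (λ v≈a → a≉b (sym (trans b≈v v≈a)))))
      where
      b≈v : label′ b ≡ label v
      b≈v = trans (cong label b≡u) u≈v
    covers′ : ∀ {p q} → Adj H p q → ∃[ a ] ∃[ b ] (label′ a ≡ p × label′ b ≡ q × Adj S/uv a b)
    covers′ {p} {q} p~q with covers p~q
    ... | x , y , x≈p , y≈q , x~y = quotient x , quotient y , x≈p′ , y≈q′ , quotient-~ x~y λ eq →
        Graph.~-irrefl H (trans (sym x≈p′) (trans (cong label′ eq) y≈q′)) p~q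
      where
      x≈p′ : label′ (quotient x) ≡ p
      x≈p′ = trans (label′-quotient x) x≈p
      y≈q′ : label′ (quotient y) ≡ q
      y≈q′ = trans (label′-quotient y) y≈q

-- Edges inside a class are contracted until none is left. Then a connected class is a single vertex
-- and `label` is an isomorphism.
contractAll : ∀ {s h} (S : Graph s) (H : Graph h) → ContractionMap S H →
  ∃[ k ] Σ[ K ∈ Graph k ] (S ContractsTo K × K ≅ H)
contractAll {s} S H M
  with any? (λ u → any? (λ v → Graph._~?_ S u v ×-dec (ContractionMap.label M u ≟ᶠ ContractionMap.label M v)))
contractAll {suc m} S H M | yes (u , v , u~v , u≈v)
  with contractAll (contract S u v u~v) H (ContractEdge.quotientMap S H M u v u~v u≈v)
... | k , K , contracts , K≅H = k , K , step u v u~v contracts , K≅H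
contractAll {s} S H M | no ¬inner = s , S , done ,
    mk↔ₛ′ label (proj₁ ∘ surjective) (proj₂ ∘ surjective) (λ x → label-injective (proj₂ (surjective (label x)))) ,
    λ x y → mk⇔ (λ x~y → preserves x~y (λ x≈y → ¬inner (x , y , x~y , x≈y))) λ p~q →
      let x′ , y′ , x′≈x , y′≈y , x′~y′ = covers p~q
      in subst₂ (Adj S) (label-injective x′≈x) (label-injective y′≈y) x′~y′
  where
  open ContractionMap M
  label-injective : ∀ {x y} → label x ≡ label y → x ≡ y
  label-injective {x} {y} x≈y with connected x y x≈y
  ... | ε       = refl
  ... | e ◅ _   = contradiction (_ , _ , e) ¬inner

-- Minors from branch sets

module _ {n : ℕ} (G : Graph n) where

  StepIn : (Fin n → Set) → Fin n → Fin n → Set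
  StepIn U x y = Adj G x y × U x × U y

  WalkIn : (Fin n → Set) → Fin n → Fin n → Set
  WalkIn U = Star (StepIn U)

record BranchSets {h n} (H : Graph h) (G : Graph n) : Set₁ where
  field
    Branch    : Fin h → Fin n → Set
    branch?   : ∀ p v → Dec (Branch p v)
    disjoint  : ∀ {p q v} → Branch p v → Branch q v → p ≡ q
    nonempty  : ∀ p → ∃[ v ] Branch p v
    connected : ∀ {p x y} → Branch p x → Branch p y → WalkIn G (Branch p) x y
    joined    : ∀ {p q} → Adj H p q → ∃[ x ] ∃[ y ] (Branch p x × Branch q y × Adj G x y)

lookup-injective : ∀ {A : Set} {xs : List A} → Unique xs → Injective _≡_ _≡_ (lookup xs)
lookup-injective (_ ∷ _)  {zero}  {zero}  _  = refl
lookup-injective {xs = x ∷ xs} (x∉ ∷ _) {zero}  {suc j} eq = contradiction eq (All.lookup x∉ (∈-lookup j))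
lookup-injective {xs = x ∷ xs} (x∉ ∷ _) {suc i} {zero}  eq = contradiction (sym eq) (All.lookup x∉ (∈-lookup i))
lookup-injective (_ ∷ xs!) {suc i} {suc j} eq = cong suc (lookup-injective xs! eq)

module BranchSubgraph {h n : ℕ} (H : Graph h) (G : Graph n) (B : BranchSets H G) where
  open BranchSets B

  used? : ∀ v → Dec (∃[ p ] Branch p v)
  used? v = any? (λ p → branch? p v)

  used : List (Fin n)
  used = filter used? (allFin n)

  ι : Fin (length used) → Fin n
  ι = lookup used

  branchOf : ∀ x → ∃[ p ] Branch p (ι x)
  branchOf x = proj₂ (∈-filter⁻ used? {xs = allFin n} (∈-lookup x))

  label : Fin (length used) → Fin h
  label x = proj₁ (branchOf x)

  -- Edges between branch sets whose labels are not adjacent in `H` are dropped, as `preserves`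
  -- demands.
  S : Graph (length used)
  S = record
    { _~_      = λ x y → Adj G (ι x) (ι y) × (label x ≡ label y ⊎ Adj H (label x) (label y))
    ; ~-sym    = λ { (e , inj₁ eq) → Graph.~-sym G e , inj₁ (sym eq)
                   ; (e , inj₂ f)  → Graph.~-sym G e , inj₂ (Graph.~-sym H f) }
    ; ~-irrefl = λ x≡y (e , _) → Graph.~-irrefl G (cong ι x≡y) e
    ; _~?_     = λ x y → Graph._~?_ G (ι x) (ι y) ×-dec
                   ((label x ≟ᶠ label y) ⊎-dec Graph._~?_ H (label x) (label y))
    }

  position : ∀ {p v} → Branch p v → ∃[ x ] (ι x ≡ v × label x ≡ p)
  position {p} {v} v∈p = x , ιx≡v , disjoint (proj₂ (branchOf x)) (subst (Branch p) (sym ιx≡v) v∈p)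
    where
    v∈used : v ∈ used
    v∈used = ∈-filter⁺ used? (∈-allFin v) (p , v∈p)
    x : Fin (length used)
    x = index v∈used
    ιx≡v : ι x ≡ v
    ιx≡v = sym (lookup-index v∈used)

  ι-injective : Injective _≡_ _≡_ ι
  ι-injective = lookup-injective (filter⁺ used? (allFin⁺ n))

  Inner : Fin (length used) → Fin (length used) → Set
  Inner a b = Adj S a b × label a ≡ label b

  -- The ends are tied to `x` and `y` by equations, so that the recursion can run over a walk
  -- between arbitrary vertices of `G`.
  liftWalk : ∀ {p u v} → WalkIn G (Branch p) u v → ∀ x y → ι x ≡ u → ι y ≡ v →
    label x ≡ p → Star Inner x y
  liftWalk ε x y x≡u y≡u _ = subst (Star Inner x) (ι-injective (trans x≡u (sym y≡u))) ε
  liftWalk ((u~w , _ , w∈p) ◅ walk) x y refl y≡v x≈p with position w∈p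
  ... | z , refl , z≈p =
    ((u~w , inj₁ (trans x≈p (sym z≈p))) , trans x≈p (sym z≈p)) ◅ liftWalk walk z y refl y≡v z≈p

  contractionMap : ContractionMap S H
  contractionMap = record
    { label      = label
    ; surjective = λ p → let x , _ , x≈p = position (proj₂ (nonempty p)) in x , x≈p
    ; connected  = λ x y x≈y → liftWalk
        (connected (proj₂ (branchOf x)) (subst (λ p → Branch p (ι y)) (sym x≈y) (proj₂ (branchOf y))))
        x y refl refl refl
    ; preserves  = λ { (_ , inj₁ x≈y) x≉y → contradiction x≈y x≉y ; (_ , inj₂ e) _ → e }
    ; covers     = covers
    }
    where
    covers : ∀ {p q} → Adj H p q → ∃[ x ] ∃[ y ] (label x ≡ p × label y ≡ q × Adj S x y)
    covers p~q with joined p~q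
    ... | u , v , u∈p , v∈q , u~v with position u∈p | position v∈q
    ...   | x , refl , refl | y , refl , refl = x , y , refl , refl , u~v , inj₂ p~q

  isMinor : H IsMinorOf G
  isMinor = length used , S , (ι , ι-injective , proj₁) , contractAll S H contractionMap

-- Finite subsets as termination measures

-- Strict inclusion of finite subsets is well-founded in both directions: growing balls and
-- shrinking sets of left-over vertices are measured by it.
subset : ∀ {n} {P : Fin n → Set} → (∀ v → Dec (P v)) → Subset n
subset P? = tabulate (λ v → does (P? v))

module _ {n : ℕ} {P : Fin n → Set} (P? : ∀ v → Dec (P v)) where

  ∈-subset⁺ : ∀ {v} → P v → v ∈ˢ subset P?
  ∈-subset⁺ {v} Pv = lookup⇒[]= v _ (trans (lookup∘tabulate _ v) (dec-true (P? v) Pv))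

  ∈-subset⁻ : ∀ {v} → v ∈ˢ subset P? → P v
  ∈-subset⁻ {v} v∈ with P? v | trans (sym (lookup∘tabulate (does ∘ P?) v)) ([]=⇒lookup v∈)
  ... | yes Pv | _ = Pv

subset-⊂ : ∀ {n} {P Q : Fin n → Set} (P? : ∀ v → Dec (P v)) (Q? : ∀ v → Dec (Q v)) →
  (∀ {v} → P v → Q v) → ∀ {v} → Q v → ¬ P v → subset P? ⊂ subset Q?
subset-⊂ P? Q? P⇒Q Qv ¬Pv =
  (∈-subset⁺ Q? ∘ P⇒Q ∘ ∈-subset⁻ P?) , _ , ∈-subset⁺ Q? Qv , ¬Pv ∘ ∈-subset⁻ P?

-- Breadth-first search

module BreadthFirst {n : ℕ} (G : Graph n) (U : Fin n → Set) (U? : ∀ v → Dec (U v))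
  (r : Fin n) (Ur : U r) where
  open Graph G

  Within : ℕ → Fin n → Set
  Within zero    v = v ≡ r
  Within (suc k) v = Within k v ⊎ (∃[ u ] (Within k u × u ~ v × U v))

  within? : ∀ k v → Dec (Within k v)
  within? zero    v = v ≟ᶠ r
  within? (suc k) v = within? k v ⊎-dec any? (λ u → within? k u ×-dec ((u ~? v) ×-dec U? v))

  within-mono : ∀ {k l v} → k ≤ l → Within k v → Within l v
  within-mono {l = zero}  z≤n       w = w
  within-mono {l = suc l} z≤n       w = inj₁ (within-mono {l = l} z≤n w)
  within-mono             (s≤s k≤l) (inj₁ w) = inj₁ (within-mono k≤l w)
  within-mono             (s≤s k≤l) (inj₂ (u , w , e)) = inj₂ (u , within-mono k≤l w , e)

  abstract
    -- Balls that grew at every radius would form an infinite strictly increasing chain of subsets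
    -- of a finite set.
    stabilise : ∃[ K ] (∀ v → Within (suc K) v → Within K v)
    stabilise = go 0 (⊃-wellFounded _)
      where
      go : ∀ k → Acc _⊃_ (subset (within? k)) → ∃[ K ] (∀ v → Within (suc K) v → Within K v)
      go k (acc rec) with any? (λ v → within? (suc k) v ×-dec ¬? (within? k v))
      ... | yes (v , w , ¬w) = go (suc k) (rec (subset-⊂ (within? k) (within? (suc k)) inj₁ w ¬w))
      ... | no  ¬grows       = k , λ v w → decidable-stable (within? k v) (λ ¬w → ¬grows (v , w , ¬w))

  radius : ℕ
  radius = proj₁ stabilise

  Component : Fin n → Set
  Component = Within radius

  component? : ∀ v → Dec (Component v)
  component? = within? radius

  -- A ball that does not grow once never grows again: by `stabilise` it absorbs each further step.
  within⇒component : ∀ k {v} → Within k v → Component v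
  within⇒component zero    w                        = within-mono z≤n w
  within⇒component (suc k) (inj₁ w)                 = within⇒component k w
  within⇒component (suc k) (inj₂ (u , w , u~v , Uv)) =
    proj₂ stabilise _ (inj₂ (u , within⇒component k w , u~v , Uv))

  component-root : Component r
  component-root = within⇒component 0 refl

  component-step : ∀ {u v} → Component u → u ~ v → U v → Component v
  component-step u∈C u~v Uv = within⇒component (suc radius) (inj₂ (_ , u∈C , u~v , Uv))

  component-walk : ∀ {u v} → Component u → WalkIn G U u v → Component v
  component-walk u∈C ε                       = u∈C
  component-walk u∈C ((u~w , _ , Uw) ◅ walk) = component-walk (component-step u∈C u~w Uw) walk

  component⊆U : ∀ {v} → Component v → U v
  component⊆U = within⊆U radius
    where
    within⊆U : ∀ k {v} → Within k v → U v
    within⊆U zero    refl                    = Ur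
    within⊆U (suc k) (inj₁ w)                = within⊆U k w
    within⊆U (suc k) (inj₂ (_ , _ , _ , Uv)) = Uv

  walk-from-root : ∀ {v} → Component v → WalkIn G U r v
  walk-from-root = walk radius
    where
    walk : ∀ k {v} → Within k v → WalkIn G U r v
    walk zero    refl                      = ε
    walk (suc k) (inj₁ w)                  = walk k w
    walk (suc k) (inj₂ (u , w , u~v , Uv)) =
      walk k w ◅◅ ((u~v , component⊆U (within⇒component k w) , Uv) ◅ ε)

  -- The least k ≤ K with Within k v, or K if there is none.
  leastWithin : ℕ → Fin n → ℕ
  leastWithin zero    v = 0
  leastWithin (suc K) v with within? K v
  ... | yes _ = leastWithin K v
  ... | no  _ = suc K

  leastWithin-minimal : ∀ K {k v} → Within k v → leastWithin K v ≤ k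
  leastWithin-minimal zero            w = z≤n
  leastWithin-minimal (suc K) {k} {v} w with within? K v
  ... | yes _ = leastWithin-minimal K w
  ... | no ¬w = ℕₚ.≰⇒> (λ k≤K → ¬w (within-mono k≤K w))

  within-leastWithin : ∀ K {v} → Within K v → Within (leastWithin K v) v
  within-leastWithin zero        w = w
  within-leastWithin (suc K) {v} w with within? K v
  ... | yes w′ = within-leastWithin K w′
  ... | no  _  = w

  dist : Fin n → ℕ
  dist = leastWithin radius

  within-dist : ∀ {v} → Component v → Within (dist v) v
  within-dist = within-leastWithin radius

  dist-step : ∀ {u v} → Component u → u ~ v → U v → dist v ≤ suc (dist u)
  dist-step u∈C u~v Uv = leastWithin-minimal radius {suc _} (inj₂ (_ , within-dist u∈C , u~v , Uv))

  dist≡0⇒root : ∀ {v} → Component v → dist v ≡ 0 → v ≡ r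
  dist≡0⇒root {v} v∈C d≡0 = subst (λ k → Within k v) d≡0 (within-dist v∈C)

  IsParent : Fin n → Fin n → Set
  IsParent v u = u ~ v × Component u × suc (dist u) ≡ dist v

  isParent? : ∀ v u → Dec (IsParent v u)
  isParent? v u = (u ~? v) ×-dec (component? u ×-dec (suc (dist u) ℕₚ.≟ dist v))

  abstract
    parent : Fin n → Fin n
    parent v with any? (isParent? v)
    ... | yes (u , _) = u
    -- The root, which has no parent, is sent to itself; this keeps `parent` inside the component
    -- and never increases the distance.
    ... | no  _       = v

    -- The vertex `u` from which the search reached `v` lies within distance `k`; were it closer,
    -- `v` would be closer too.
    has-parent : ∀ {k v} → Component v → dist v ≡ suc k → ∃[ u ] IsParent v u
    has-parent {k} {v} v∈C d≡ with subst (λ k → Within k v) d≡ (within-dist v∈C)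
    ... | inj₁ w = contradiction (subst (_≤ k) d≡ (leastWithin-minimal radius w)) ℕₚ.1+n≰n
    ... | inj₂ (u , w , u~v , Uv) = u , u~v , u∈C , ℕₚ.≤-antisym
        (subst (suc (dist u) ≤_) (sym d≡) (s≤s (leastWithin-minimal radius w)))
        (dist-step u∈C u~v Uv)
      where
      u∈C : Component u
      u∈C = within⇒component k w

    parent-isParent : ∀ {k v} → Component v → dist v ≡ suc k → IsParent v (parent v)
    parent-isParent {v = v} v∈C d≡ with any? (isParent? v)
    ... | yes (_ , p) = p
    ... | no  none    = contradiction (has-parent v∈C d≡) none

    parent-component : ∀ {v} → Component v → Component (parent v)
    parent-component {v} v∈C with any? (isParent? v)
    ... | yes (_ , _ , u∈C , _) = u∈C
    ... | no  _                 = v∈C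

    dist-parent : ∀ v → dist (parent v) ≤ dist v
    dist-parent v with any? (isParent? v)
    ... | yes (u , _ , _ , eq) = subst (dist u ≤_) eq (ℕₚ.n≤1+n _)
    ... | no  _                = ℕₚ.≤-refl

  ancestor : ℕ → Fin n → Fin n
  ancestor zero    v = v
  ancestor (suc j) v = parent (ancestor j v)

  ancestor-component : ∀ j {v} → Component v → Component (ancestor j v)
  ancestor-component zero    v∈C = v∈C
  ancestor-component (suc j) v∈C = parent-component (ancestor-component j v∈C)

  dist-ancestor : ∀ j v → dist (ancestor j v) ≤ dist v
  dist-ancestor zero    v = ℕₚ.≤-refl
  dist-ancestor (suc j) v = ℕₚ.≤-trans (dist-parent (ancestor j v)) (dist-ancestor j v)

  -- v lies on the tree path from y to r.  This form makes it obvious that the path meets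
  -- every distance layer at most once.
  OnPath : Fin n → Fin n → Set
  OnPath y v = v ≡ ancestor (dist y ∸ dist v) y

  onPath-self : ∀ y → OnPath y y
  onPath-self y = cong (λ j → ancestor j y) (sym (ℕₚ.n∸n≡0 (dist y)))

  onPath-unique : ∀ {y u v} → OnPath y u → OnPath y v → dist u ≡ dist v → u ≡ v
  onPath-unique {y} pu pv d≡ = trans pu (trans (cong (λ k → ancestor (dist y ∸ k) y) d≡) (sym pv))

  onPath-component : ∀ {y v} → Component y → OnPath y v → Component v
  onPath-component {y} {v} y∈C p = subst Component (sym p) (ancestor-component (dist y ∸ dist v) y∈C)

  -- One step down in distance is one more step up from `y`; `dist v ≤ dist y` makes the truncated
  -- subtraction exact.
  onPath-parent : ∀ {k y v} → Component y → OnPath y v → dist v ≡ suc k → OnPath y (parent v)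
  onPath-parent {k} {y} {v} y∈C p d≡ = begin
    parent v                                   ≡⟨ cong parent p ⟩
    ancestor (suc (dist y ∸ dist v)) y       ≡⟨ cong (λ j → ancestor j y) (sym (ℕₚ.+-∸-assoc 1 dv≤dy)) ⟩
    ancestor (suc (dist y) ∸ dist v) y       ≡⟨ cong (λ k → ancestor (suc (dist y) ∸ k) y) (sym d′) ⟩
    ancestor (dist y ∸ dist (parent v)) y    ∎
    where
    open ≡-Reasoning
    dv≤dy : dist v ≤ dist y
    dv≤dy = subst (λ x → dist x ≤ dist y) (sym p) (dist-ancestor (dist y ∸ dist v) y)
    d′ : suc (dist (parent v)) ≡ dist v
    d′ = proj₂ (proj₂ (parent-isParent (onPath-component y∈C p) d≡))

-- Distances that differ by at most two are told apart by their residues modulo 3.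
residue : ℕ → Fin 3
residue 0                   = zero
residue 1                   = suc zero
residue 2                   = suc (suc zero)
residue (suc (suc (suc k))) = residue k

residue-injective : ∀ k l → k ≤ 2 + l → l ≤ 2 + k → residue k ≡ residue l → k ≡ l
residue-injective 0 0 _ _ _ = refl
residue-injective 1 1 _ _ _ = refl
residue-injective 2 2 _ _ _ = refl
residue-injective (suc (suc (suc k))) (suc (suc (suc l))) (s≤s (s≤s (s≤s p))) (s≤s (s≤s (s≤s q))) eq =
  cong (3 +_) (residue-injective k l p q eq)
residue-injective 0 1 _ _ ()
residue-injective 0 2 _ _ ()
residue-injective 1 0 _ _ ()
residue-injective 1 2 _ _ ()
residue-injective 2 0 _ _ ()
residue-injective 2 1 _ _ ()
residue-injective 0 (suc (suc (suc l))) _ (s≤s (s≤s ())) _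
residue-injective 1 3 _ _ ()
residue-injective 1 (suc (suc (suc (suc l)))) _ (s≤s (s≤s (s≤s ()))) _
residue-injective 2 3 _ _ ()
residue-injective 2 4 _ _ ()
residue-injective 2 (suc (suc (suc (suc (suc l))))) _ (s≤s (s≤s (s≤s (s≤s ())))) _
residue-injective (suc (suc (suc k))) 0 (s≤s (s≤s ())) _ _
residue-injective 3 1 _ _ ()
residue-injective (suc (suc (suc (suc k)))) 1 (s≤s (s≤s (s≤s ()))) _ _
residue-injective 3 2 _ _ ()
residue-injective 4 2 _ _ ()
residue-injective (suc (suc (suc (suc (suc k))))) 2 (s≤s (s≤s (s≤s (s≤s ())))) _ _

-- Partition into connected bags

module _ {n : ℕ} (G : Graph n) where

  reverseWalk : ∀ {U x y} → WalkIn G U x y → WalkIn G U y x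
  reverseWalk = Star.reverse (λ (e , Ux , Uy) → Graph.~-sym G e , Uy , Ux)

  mapWalk : ∀ {U V : Fin n → Set} → (∀ {v} → U v → V v) → ∀ {x y} → WalkIn G U x y → WalkIn G V x y
  mapWalk f = Star.map (λ (e , Ux , Uy) → e , f Ux , f Uy)

module BagPartition {h n : ℕ} (H : Graph h) (G : Graph n) where
  open Graph G

  -- Middle vertices in bags before `j` are left out: such a vertex has a smaller key than `u` and
  -- `v` in bag `j`, so it may be the centre of a star containing both.
  Near : (Fin n → ℕ) → ℕ → Fin n → Fin n → Set
  Near τ j u v = u ~ v ⊎ (∃[ x ] (j ≤ τ x × u ~ x × x ~ v))

  -- What the colouring needs to know about bag j, relative to the vertices that do not lie in
  -- earlier bags.
  record BagColouring (τ : Fin n → ℕ) (j : ℕ) : Set where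
    field
      local             : Fin n → Fin 3 × Fin (suc h)
      separates         : ∀ {u v} → τ u ≡ j → τ v ≡ j → u ≢ v →
                          Near τ j u v → local u ≢ local v
      attached          : List ℕ
      attached-length   : length attached ≤ h
      attached-complete : ∀ {v x a} → τ v ≡ j → v ≡ x ⊎ v ~ x → j ≤ τ x → x ~ a → τ a < j →
                          τ a ∈ attached

  -- The bags chosen so far are the fibres of τ over 0, …, m − 1; unassigned vertices
  -- have m ≤ τ v, so {v | j ≤ τ v} is the set left over at stage j at every later stage.
  record Stage (τ : Fin n → ℕ) (m : ℕ) : Set where
    field
      bag-connected : ∀ {j x y} → j < m → τ x ≡ j → τ y ≡ j → WalkIn G (λ v → τ v ≡ j) x y
      bags-adjacent : ∀ {x y a b} → m ≤ τ x → WalkIn G (λ v → m ≤ τ v) x y → x ~ a → y ~ b →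
                      τ a < m → τ b < m → τ a ≢ τ b →
                      ∃[ a′ ] ∃[ b′ ] (τ a′ ≡ τ a × τ b′ ≡ τ b × a′ ~ b′)
      bag-colouring : ∀ {j} → j < m → BagColouring τ j

  module NextBag {τ : Fin n → ℕ} {m : ℕ} (stage : Stage τ m) (r : Fin n) (m≤τr : m ≤ τ r) where
    open Stage stage
    open BreadthFirst G (λ v → m ≤ τ v) (λ v → m ℕₚ.≤? τ v) r m≤τr

    Attached : ℕ → Set
    Attached i = ∃[ y ] ∃[ a ] (Component y × y ~ a × τ a ≡ i)

    attached? : ∀ i → Dec (Attached i)
    attached? i = any? (λ y → any? (λ a → component? y ×-dec ((y ~? a) ×-dec (τ a ℕₚ.≟ i))))

    abstract
      bagsAround : List ℕ
      bagsAround = filter attached? (upTo m)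

      ∈-bagsAround : ∀ {y a} → Component y → y ~ a → τ a < m → τ a ∈ bagsAround
      ∈-bagsAround y∈C y~a τa<m = ∈-filter⁺ attached? (∈-upTo⁺ τa<m) (_ , _ , y∈C , y~a , refl)

      around : ∀ i → lookup bagsAround i ∈ upTo m × Attached (lookup bagsAround i)
      around i = ∈-filter⁻ attached? {xs = upTo m} (∈-lookup i)

      bagsAround-unique : Unique bagsAround
      bagsAround-unique = filter⁺ attached? (upTo⁺ m)

    -- The first `h` earlier bags around the component serve whole as branch sets. They are
    -- connected and pairwise adjacent, so they realise every edge of `H`.
    branchSets : h ≤ length bagsAround → BranchSets H G
    branchSets h≤ = record
      { Branch    = λ p v → τ v ≡ g p
      ; branch?   = λ p v → τ v ℕₚ.≟ g p
      ; disjoint  = λ v∈p v∈q → g-injective (trans (sym v∈p) v∈q)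
      ; nonempty  = λ p → let _ , a , _ , _ , τa≡ = proj₂ (around (inject≤ p h≤)) in a , τa≡
      ; connected = λ {p} → bag-connected (g<m p)
      ; joined    = joined
      }
      where
      g : Fin h → ℕ
      g p = lookup bagsAround (inject≤ p h≤)
      g<m : ∀ p → g p < m
      g<m p = ∈-upTo⁻ (proj₁ (around (inject≤ p h≤)))
      g-injective : ∀ {p q} → g p ≡ g q → p ≡ q
      g-injective eq = inject≤-injective h≤ h≤ _ _ (lookup-injective bagsAround-unique eq)
      joined : ∀ {p q} → Adj H p q → ∃[ x ] ∃[ y ] (τ x ≡ g p × τ y ≡ g q × x ~ y)
      joined {p} {q} p~q with proj₂ (around (inject≤ p h≤)) | proj₂ (around (inject≤ q h≤))
      ... | x , a , x∈C , x~a , τa≡ | y , b , y∈C , y~b , τb≡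
        with bags-adjacent (component⊆U x∈C)
               -- The two attaching vertices are linked through the root, inside the left-over
               -- vertices.
               (reverseWalk G (walk-from-root x∈C) ◅◅ walk-from-root y∈C) x~a y~b
               (subst (_< m) (sym τa≡) (g<m p)) (subst (_< m) (sym τb≡) (g<m q))
               (λ eq → Graph.~-irrefl H (g-injective (trans (sym τa≡) (trans eq τb≡))) p~q)
      ...   | a′ , b′ , τa′≡ , τb′≡ , a′~b′ = a′ , b′ , trans τa′≡ τa≡ , trans τb′≡ τb≡ , a′~b′

    -- The root is a target too, so that the bag is nonempty even if no earlier bag is attached.
    target : Fin (suc (length bagsAround)) → Fin n
    target zero    = r
    target (suc i) = proj₁ (proj₂ (around i))

    target-component : ∀ i → Component (target i)
    target-component zero    = component-root
    target-component (suc i) = proj₁ (proj₂ (proj₂ (proj₂ (around i))))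

    Bag : Fin n → Set
    Bag v = ∃[ i ] OnPath (target i) v

    abstract
      bag? : ∀ v → Dec (Bag v)
      bag? v = any? (λ i → v ≟ᶠ ancestor (dist (target i) ∸ dist v) (target i))

    bag⊆component : ∀ {v} → Bag v → Component v
    bag⊆component (i , p) = onPath-component (target-component i) p

    target∈bag : ∀ i → Bag (target i)
    target∈bag i = i , onPath-self (target i)

    -- Each path is closed under `parent` up to the root, so climbing the tree stays in the bag.
    -- Hence the bag is connected.
    walk-to-root : ∀ k {v} → dist v ≡ k → Bag v → WalkIn G Bag v r
    walk-to-root zero        d≡ v∈B with refl ← dist≡0⇒root (bag⊆component v∈B) d≡ = ε
    walk-to-root (suc k) {v} d≡ v∈B@(i , p) with parent-isParent (bag⊆component v∈B) d≡
    ... | u~v , _ , d′ = (~-sym u~v , v∈B , u∈B) ◅ walk-to-root k (ℕₚ.suc-injective (trans d′ d≡)) u∈B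
      where
      u∈B : Bag (parent v)
      u∈B = i , onPath-parent (target-component i) p d≡

    -- One of the targets was chosen next to the bag of `b`.
    bag-meets : ∀ {y b} → Component y → y ~ b → τ b < m →
      ∃[ c ] ∃[ b′ ] (Bag c × τ b′ ≡ τ b × c ~ b′)
    bag-meets y∈C y~b τb<m = target (suc i) , proj₁ (proj₂ att) , target∈bag (suc i) ,
        trans (proj₂ (proj₂ (proj₂ (proj₂ att)))) (sym (lookup-index τb∈)) , proj₁ (proj₂ (proj₂ (proj₂ att)))
      where
      τb∈ = ∈-bagsAround y∈C y~b τb<m
      i : Fin (length bagsAround)
      i = index τb∈
      att : Attached (lookup bagsAround i)
      att = proj₂ (around i)

    data Status (v : Fin n) : Set where
      old   : τ v < m → Status v
      now   : Bag v → Status v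
      later : m ≤ τ v → ¬ Bag v → Status v

    abstract
      status : ∀ v → Status v
      status v with bag? v
      ... | yes v∈B = now v∈B
      ... | no  v∉B with m ℕₚ.≤? τ v
      ...   | yes m≤τv = later m≤τv v∉B
      ...   | no  m≰τv = old (ℕₚ.≰⇒> m≰τv)

    -- Vertices still left over move to `suc m`, which marks them as unassigned at the next stage.
    rank : ∀ {v} → Status v → ℕ
    rank {v} (old _)     = τ v
    rank     (now _)     = m
    rank     (later _ _) = suc m

    τ⁺ : Fin n → ℕ
    τ⁺ v = rank (status v)

    τ⁺-old : ∀ {v} → τ v < m → τ⁺ v ≡ τ v
    τ⁺-old {v} τv<m = go (status v)
      where
      go : (s : Status v) → rank s ≡ τ v
      go (old _)        = refl
      go (now v∈B)      = contradiction (component⊆U (bag⊆component v∈B)) (ℕₚ.<⇒≱ τv<m)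
      go (later m≤τv _) = contradiction m≤τv (ℕₚ.<⇒≱ τv<m)

    τ⁺-bag : ∀ {v} → Bag v → τ⁺ v ≡ m
    τ⁺-bag {v} v∈B = go (status v)
      where
      go : (s : Status v) → rank s ≡ m
      go (old τv<m)    = contradiction (component⊆U (bag⊆component v∈B)) (ℕₚ.<⇒≱ τv<m)
      go (now _)       = refl
      go (later _ v∉B) = contradiction v∈B v∉B

    τ⁺<m⇒old : ∀ {v} → τ⁺ v < m → τ v ≡ τ⁺ v
    τ⁺<m⇒old {v} = go (status v)
      where
      go : (s : Status v) → rank s < m → τ v ≡ rank s
      go (old _)     _   = refl
      go (now _)     m<m = contradiction m<m (ℕₚ.<-irrefl refl)
      go (later _ _) m<m = contradiction m<m (ℕₚ.≤⇒≯ (ℕₚ.n≤1+n m))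

    τ⁺≡m⇒bag : ∀ {v} → τ⁺ v ≡ m → Bag v
    τ⁺≡m⇒bag {v} = go (status v)
      where
      go : (s : Status v) → rank s ≡ m → Bag v
      go (old τv<m)  eq = contradiction eq (ℕₚ.<⇒≢ τv<m)
      go (now v∈B)   _  = v∈B
      go (later _ _) eq = contradiction eq ℕₚ.1+n≢n

    -- Old vertices keep their number, and all others already had a number of at least `m`.
    ≤τ⁺⇒≤τ : ∀ {j v} → j ≤ m → j ≤ τ⁺ v → j ≤ τ v
    ≤τ⁺⇒≤τ {j} {v} j≤m = go (status v)
      where
      go : (s : Status v) → j ≤ rank s → j ≤ τ v
      go (old _)        j≤τv = j≤τv
      go (now v∈B)      _    = ℕₚ.≤-trans j≤m (component⊆U (bag⊆component v∈B))
      go (later m≤τv _) _    = ℕₚ.≤-trans j≤m m≤τv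

    m<τ⁺⇒m≤τ : ∀ {v} → suc m ≤ τ⁺ v → m ≤ τ v
    m<τ⁺⇒m≤τ m<τ⁺ = ≤τ⁺⇒≤τ ℕₚ.≤-refl (ℕₚ.<⇒≤ m<τ⁺)

    τ⁺-fibre : ∀ {u v} → τ⁺ v < m → τ u ≡ τ v → τ⁺ u ≡ τ⁺ v
    τ⁺-fibre τ⁺v<m eq =
      trans (τ⁺-old (subst (_< m) (sym (trans eq (τ⁺<m⇒old τ⁺v<m))) τ⁺v<m)) (trans eq (τ⁺<m⇒old τ⁺v<m))

    below : ∀ {j v} → j < m → τ⁺ v ≡ j → τ v ≡ j
    below j<m eq = trans (τ⁺<m⇒old (subst (_< m) (sym eq) j<m)) eq

    -- Bag `j` keeps its vertices and no vertex joins those left over at stage `j`, so each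
    -- condition reduces to the one for `τ`.
    keepColouring : ∀ {j} → j < m → BagColouring τ j → BagColouring τ⁺ j
    keepColouring {j} j<m B = record
      { local             = local
      ; separates         = λ u∈j v∈j u≢v near → separates (below j<m u∈j) (below j<m v∈j) u≢v (near⁻ near)
      ; attached          = attached
      ; attached-length   = attached-length
      ; attached-complete = λ v∈j v-x j≤τ⁺x x~a τ⁺a<j →
          let τa≡ = τ⁺<m⇒old (ℕₚ.<-trans τ⁺a<j j<m) in
          subst (_∈ attached) τa≡ (attached-complete (below j<m v∈j) v-x (≤τ⁺⇒≤τ (ℕₚ.<⇒≤ j<m) j≤τ⁺x) x~a
            (subst (_< j) (sym τa≡) τ⁺a<j))
      }
      where
      open BagColouring B
      near⁻ : ∀ {u v} → Near τ⁺ j u v → Near τ j u v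
      near⁻ (inj₁ e)             = inj₁ e
      near⁻ (inj₂ (x , j≤τ , e)) = inj₂ (x , ≤τ⁺⇒≤τ (ℕₚ.<⇒≤ j<m) j≤τ , e)

    module _ (few : length bagsAround < h) where

      few′ : suc (length bagsAround) ≤ suc h
      few′ = ℕₚ.m≤n⇒m≤1+n few

      -- A vertex such as the root can lie on several paths; one of them is fixed. Outside the bag
      -- the value is a default.
      pathIndex : Fin n → Fin (suc h)
      pathIndex v with bag? v
      ... | yes (i , _) = inject≤ i few′
      ... | no  _       = zero

      pathIndex-onPath : ∀ {v} → Bag v → ∃[ i ] (inject≤ i few′ ≡ pathIndex v × OnPath (target i) v)
      pathIndex-onPath {v} v∈B with bag? v
      ... | yes (i , p) = i , refl , p
      ... | no  v∉B     = contradiction v∈B v∉B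

      -- Each step inside the component raises the distance by at most one, and a left-over middle
      -- vertex belongs to the component.
      dist-near : ∀ {u v} → Component u → Component v → Near τ⁺ m u v → dist v ≤ 2 + dist u
      dist-near u∈C v∈C (inj₁ u~v) = ℕₚ.m≤n⇒m≤1+n (dist-step u∈C u~v (component⊆U v∈C))
      dist-near u∈C v∈C (inj₂ (x , m≤τ⁺x , u~x , x~v)) =
        ℕₚ.≤-trans (dist-step (component-step u∈C u~x m≤τx) x~v (component⊆U v∈C))
          (s≤s (dist-step u∈C u~x m≤τx))
        where
        m≤τx = ≤τ⁺⇒≤τ {v = x} ℕₚ.≤-refl m≤τ⁺x

      near-sym : ∀ {u v} → Near τ⁺ m u v → Near τ⁺ m v u
      near-sym (inj₁ u~v)                     = inj₁ (~-sym u~v)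
      near-sym (inj₂ (x , m≤τ⁺x , u~x , x~v)) = inj₂ (x , m≤τ⁺x , ~-sym x~v , ~-sym u~x)

      newColouring : BagColouring τ⁺ m
      newColouring = record
        { local             = λ v → residue (dist v) , pathIndex v
        ; separates         = λ u∈m v∈m → separates (τ⁺≡m⇒bag u∈m) (τ⁺≡m⇒bag v∈m)
        ; attached          = bagsAround
        ; attached-length   = ℕₚ.<⇒≤ few
        ; attached-complete = λ v∈m v-x m≤τ⁺x x~a τ⁺a<m →
            let τa≡ = τ⁺<m⇒old τ⁺a<m in
            subst (_∈ bagsAround) τa≡ (∈-bagsAround
              (next (bag⊆component (τ⁺≡m⇒bag v∈m)) v-x (≤τ⁺⇒≤τ ℕₚ.≤-refl m≤τ⁺x)) x~a
              (subst (_< m) (sym τa≡) τ⁺a<m))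
        }
        where
        next : ∀ {v x} → Component v → v ≡ x ⊎ v ~ x → m ≤ τ x → Component x
        next v∈C (inj₁ refl) _    = v∈C
        next v∈C (inj₂ v~x)  m≤τx = component-step v∈C v~x m≤τx
        separates : ∀ {u v} → Bag u → Bag v → u ≢ v → Near τ⁺ m u v →
          (residue (dist u) , pathIndex u) ≢ (residue (dist v) , pathIndex v)
        separates {u} {v} u∈B v∈B u≢v near eq with pathIndex-onPath u∈B | pathIndex-onPath v∈B
        ... | i , i≡ , pu | j , j≡ , pv
          with refl ← inject≤-injective few′ few′ i j (trans i≡ (trans (cong proj₂ eq) (sym j≡))) =
          u≢v (onPath-unique pu pv (residue-injective (dist u) (dist v)
            (dist-near v∈C u∈C (near-sym near)) (dist-near u∈C v∈C near) (cong proj₁ eq)))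
          where
          u∈C = bag⊆component u∈B
          v∈C = bag⊆component v∈B

      nextStage : Stage τ⁺ (suc m)
      nextStage = record
        { bag-connected = connected
        ; bags-adjacent = pairwise
        ; bag-colouring = colouring
        }
        where
        colouring : ∀ {j} → j < suc m → BagColouring τ⁺ j
        colouring (s≤s j≤m) with ℕₚ.m≤n⇒m<n∨m≡n j≤m
        ... | inj₁ j<m  = keepColouring j<m (bag-colouring j<m)
        ... | inj₂ refl = newColouring

        connected : ∀ {j x y} → j < suc m → τ⁺ x ≡ j → τ⁺ y ≡ j → WalkIn G (λ v → τ⁺ v ≡ j) x y
        connected (s≤s j≤m) x∈j y∈j with ℕₚ.m≤n⇒m<n∨m≡n j≤m
        ... | inj₁ j<m  = mapWalk G (λ v∈j → trans (τ⁺-old (subst (_< m) (sym v∈j) j<m)) v∈j)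
                            (bag-connected j<m (below j<m x∈j) (below j<m y∈j))
        ... | inj₂ refl = mapWalk G τ⁺-bag
                            (walk-to-root _ refl (τ⁺≡m⇒bag x∈j) ◅◅ reverseWalk G (walk-to-root _ refl (τ⁺≡m⇒bag y∈j)))

        -- As `a` is in the new bag, its left-over neighbour `x` lies in the component of `r`, and
        -- so does `y`. The new bag is adjacent to every earlier bag attached there.
        meets : ∀ {x y a b} → m ≤ τ x → WalkIn G (λ v → m ≤ τ v) x y → x ~ a → y ~ b →
          τ⁺ a ≡ m → τ⁺ b < m → ∃[ a′ ] ∃[ b′ ] (τ⁺ a′ ≡ τ⁺ a × τ⁺ b′ ≡ τ⁺ b × a′ ~ b′)
        meets m≤τx walk x~a y~b a∈m τ⁺b<m
          with bag-meets (component-walk (component-step (bag⊆component (τ⁺≡m⇒bag a∈m)) (~-sym x~a) m≤τx) walk)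
                 y~b (subst (_< m) (sym (τ⁺<m⇒old τ⁺b<m)) τ⁺b<m)
        ... | a′ , b′ , a′∈B , b′≡ , a′~b′ =
          a′ , b′ , trans (τ⁺-bag a′∈B) (sym a∈m) , τ⁺-fibre τ⁺b<m b′≡ , a′~b′

        endpoint : ∀ {x y} → m ≤ τ x → WalkIn G (λ v → m ≤ τ v) x y → m ≤ τ y
        endpoint m≤τx ε                    = m≤τx
        endpoint _    ((_ , _ , m≤τ) ◅ walk) = endpoint m≤τ walk

        pairwise : ∀ {x y a b} → suc m ≤ τ⁺ x → WalkIn G (λ v → suc m ≤ τ⁺ v) x y → x ~ a → y ~ b →
          τ⁺ a < suc m → τ⁺ b < suc m → τ⁺ a ≢ τ⁺ b →
          ∃[ a′ ] ∃[ b′ ] (τ⁺ a′ ≡ τ⁺ a × τ⁺ b′ ≡ τ⁺ b × a′ ~ b′)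
        pairwise {x} {y} {a} {b} m<x walk x~a y~b (s≤s a≤m) (s≤s b≤m) a≢b
          with ℕₚ.m≤n⇒m<n∨m≡n a≤m | ℕₚ.m≤n⇒m<n∨m≡n b≤m
        ... | inj₂ a≡m | inj₂ b≡m = contradiction (trans a≡m (sym b≡m)) a≢b
        ... | inj₂ a≡m | inj₁ b<m = meets (m<τ⁺⇒m≤τ m<x) (mapWalk G m<τ⁺⇒m≤τ walk) x~a y~b a≡m b<m
        ... | inj₁ a<m | inj₂ b≡m
          with meets (endpoint (m<τ⁺⇒m≤τ m<x) walk′) (reverseWalk G walk′) y~b x~a b≡m a<m
          where walk′ = mapWalk G m<τ⁺⇒m≤τ walk
        ...   | b′ , a′ , b′≡ , a′≡ , b′~a′ = a′ , b′ , a′≡ , b′≡ , ~-sym b′~a′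
        pairwise {x} {y} {a} {b} m<x walk x~a y~b (s≤s a≤m) (s≤s b≤m) a≢b | inj₁ a<m | inj₁ b<m
          -- Both bags are older; the walk also avoids the bags of the previous stage, which
          -- supplies the edge.
          with bags-adjacent (m<τ⁺⇒m≤τ m<x) (mapWalk G m<τ⁺⇒m≤τ walk) x~a y~b
                 (subst (_< m) (sym (τ⁺<m⇒old a<m)) a<m) (subst (_< m) (sym (τ⁺<m⇒old b<m)) b<m)
                 (λ eq → a≢b (trans (sym (τ⁺<m⇒old a<m)) (trans eq (τ⁺<m⇒old b<m))))
        ...   | a′ , b′ , a′≡ , b′≡ , a′~b′ = a′ , b′ , τ⁺-fibre a<m a′≡ , τ⁺-fibre b<m b′≡ , a′~b′

    -- The root of the new bag is no longer left over.
    progress : subset (λ v → suc m ℕₚ.≤? τ⁺ v) ⊂ subset (λ v → m ℕₚ.≤? τ v)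
    progress = subset-⊂ (λ v → suc m ℕₚ.≤? τ⁺ v) (λ v → m ℕₚ.≤? τ v) m<τ⁺⇒m≤τ m≤τr
      (λ m<τ⁺r → ℕₚ.<-irrefl (sym (τ⁺-bag (target∈bag zero))) m<τ⁺r)

  Partitioned : Set
  Partitioned = ∃[ τ ] ∃[ m ] ((∀ v → τ v < m) × (∀ j → BagColouring τ j))

  partition : H IsMinorOf G ⊎ Partitioned
  -- Before the first bag all vertices are left over and every condition is vacuous.
  partition = go (λ _ → 0) 0 (record { bag-connected = λ () ; bags-adjacent = λ _ _ _ _ () ; bag-colouring = λ () })
      (⊂-wellFounded _)
    where
    go : ∀ τ m → Stage τ m → Acc _⊂_ (subset (λ v → m ℕₚ.≤? τ v)) → H IsMinorOf G ⊎ Partitioned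
    go τ m stage (acc rec) with any? (λ v → m ℕₚ.≤? τ v)
    ... | no  none       = inj₂ (τ , m , τ<m , bag)
      where
      τ<m : ∀ v → τ v < m
      τ<m v = ℕₚ.≰⇒> (λ m≤τv → none (v , m≤τv))
      bag : ∀ j → BagColouring τ j
      bag j with j ℕₚ.<? m
      ... | yes j<m = Stage.bag-colouring stage j<m
      -- No vertex lies in bag `j`; dummy data make the family total.
      ... | no  j≮m = record
        { local             = λ _ → zero , zero
        ; separates         = λ { {u} refl → contradiction (τ<m u) j≮m }
        ; attached          = []
        ; attached-length   = z≤n
        ; attached-complete = λ { {v} refl → contradiction (τ<m v) j≮m }
        }
    ... | yes (r , m≤τr) with h ℕₚ.≤? length (NextBag.bagsAround stage r m≤τr)
    ...   | yes h≤ = inj₁ (BranchSubgraph.isMinor H G (NextBag.branchSets stage r m≤τr h≤))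
    ...   | no  h≰ = go τ⁺ (suc m) (nextStage (ℕₚ.≰⇒> h≰)) (rec progress)
      where open NextBag stage r m≤τr

-- Greedy colouring

-- If all `suc L` colours occurred, two of them would share a position by the pigeonhole principle.
fresh : ∀ {L} (xs : List (Fin (suc L))) → length xs ≤ L → ∃[ c ] ¬ c ∈ xs
fresh {L} xs len with any? (λ c → ¬? (Any.any? (c ≟ᶠ_) xs))
... | yes found = found
... | no  none  =
  let c , d , c<d , eq = Finₚ.pigeonhole (s≤s len) (λ c → index (all∈ c))
  in contradiction (trans (lookup-index (all∈ c)) (trans (cong (lookup xs) eq) (sym (lookup-index (all∈ d)))))
       (Finₚ.<⇒≢ c<d)
  where
  all∈ : ∀ c → c ∈ xs
  all∈ c = decidable-stable (Any.any? (c ≟ᶠ_) xs) (λ c∉ → none (c , c∉))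

-- Bags are coloured in increasing order; bag `m` avoids the at most `L` colours on its list.
greedyColouring : ∀ {L} (B : ℕ → List ℕ) → (∀ j → length (B j) ≤ L) → ∀ m →
  Σ[ β ∈ (ℕ → Fin (suc L)) ] (∀ {i j} → j < m → i < j → i ∈ B j → β i ≢ β j)
greedyColouring B len zero = (λ _ → zero) , λ ()
greedyColouring {L} B len (suc m) with greedyColouring B len m
... | β , β-proper with fresh (map β (B m)) (subst (_≤ L) (sym (length-map β (B m))) (len m))
...   | c , c∉ = β⁺ , β⁺-proper
  where
  β⁺ : ℕ → Fin (suc L)
  β⁺ j with j ℕₚ.≟ m
  ... | yes _ = c
  ... | no  _ = β j

  β⁺-proper : ∀ {i j} → j < suc m → i < j → i ∈ B j → β⁺ i ≢ β⁺ j
  β⁺-proper {i} {j} (s≤s j≤m) i<j i∈ with i ℕₚ.≟ m | j ℕₚ.≟ m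
  ... | yes refl | _        = contradiction j≤m (ℕₚ.<⇒≱ i<j)
  ... | no  _    | yes refl = λ eq → c∉ (subst (_∈ map β (B m)) eq (∈-map⁺ β i∈))
  ... | no  _    | no  j≢m  = β-proper (ℕₚ.≤∧≢⇒< j≤m j≢m) i<j i∈

length-concatMap : ∀ {A B : Set} (f : A → List B) {b} → (∀ x → length (f x) ≤ b) →
  ∀ xs → length (concatMap f xs) ≤ length xs * b
length-concatMap f len []       = z≤n
length-concatMap f {b} len (x ∷ xs) = subst (_≤ b + length xs * b) (sym (length-++ (f x)))
  (ℕₚ.+-mono-≤ (len x) (length-concatMap f len xs))

-- Star colouring from the bags

-- The first factor colours bags against at most `h + h * h` conflicts; the second counts pairs of a
-- residue modulo 3 and a path index.
colours : ℕ → ℕ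
colours h = suc (h + h * h) * (3 * suc h)

module Colouring {h n : ℕ} (H : Graph h) (G : Graph n) (τ : Fin n → ℕ) (m : ℕ) (τ<m : ∀ v → τ v < m)
  (bag : ∀ j → BagPartition.BagColouring H G τ j) where
  open Graph G
  open BagPartition.BagColouring

  attachedTo : ℕ → List ℕ
  attachedTo j = attached (bag j)

  -- Bags attached to attached bags are needed for paths w – x – w′ with τ w < τ x < τ w′.
  conflicts : ℕ → List ℕ
  conflicts j = attachedTo j ++ concatMap attachedTo (attachedTo j)

  conflicts-length : ∀ j → length (conflicts j) ≤ h + h * h
  conflicts-length j = subst (_≤ h + h * h) (sym (length-++ (attachedTo j)))
    (ℕₚ.+-mono-≤ (attached-length (bag j))
      (ℕₚ.≤-trans (length-concatMap attachedTo (attached-length ∘ bag) (attachedTo j))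
        (ℕₚ.*-monoˡ-≤ h (attached-length (bag j)))))

  bagColouring : Σ[ β ∈ (ℕ → Fin (suc (h + h * h))) ] (∀ {i j} → j < m → i < j → i ∈ conflicts j → β i ≢ β j)
  bagColouring = greedyColouring conflicts conflicts-length m

  β : ℕ → Fin (suc (h + h * h))
  β = proj₁ bagColouring

  attached-≢ : ∀ {u v} → τ u < τ v → τ u ∈ attachedTo (τ v) → β (τ u) ≢ β (τ v)
  attached-≢ {v = v} u<v u∈ = proj₂ bagColouring (τ<m v) u<v (∈-++⁺ˡ u∈)

  attached²-≢ : ∀ {u w v} → τ u < τ v → τ u ∈ attachedTo (τ w) → τ w ∈ attachedTo (τ v) → β (τ u) ≢ β (τ v)
  attached²-≢ {v = v} u<v u∈ w∈ = proj₂ bagColouring (τ<m v) u<v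
    (∈-++⁺ʳ (attachedTo (τ v)) (∈-concatMap⁺ attachedTo (Any.map (λ { refl → u∈ }) w∈)))

  ~⇒attached : ∀ {u v} → u ~ v → τ u < τ v → τ u ∈ attachedTo (τ v)
  ~⇒attached {v = v} u~v u<v = attached-complete (bag (τ v)) refl (inj₁ refl) ℕₚ.≤-refl (~-sym u~v) u<v

  colour : Fin n → Fin (colours h)
  colour v = combine (β (τ v)) (uncurry combine (local (bag (τ v)) v))

  colour-β : ∀ {u v} → colour u ≡ colour v → β (τ u) ≡ β (τ v)
  colour-β {u} {v} eq = proj₁ (combine-injective (β (τ u)) _ (β (τ v)) _ eq)

  colour-local : ∀ {u v} → colour u ≡ colour v → local (bag (τ u)) u ≡ local (bag (τ v)) v
  colour-local {u} {v} eq with combine-injective _ _ _ _ (proj₂ (combine-injective (β (τ u)) _ (β (τ v)) _ eq))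
  ... | eq₁ , eq₂ = cong₂ _,_ eq₁ eq₂

  same-bag : ∀ {u v} → τ u ≡ τ v → u ≢ v → BagPartition.Near H G τ (τ u) u v → colour u ≢ colour v
  same-bag {u} {v} τ≡ u≢v near eq = separates (bag (τ u)) refl (sym τ≡) u≢v near
    (trans (colour-local eq) (cong (λ j → local (bag j) v) (sym τ≡)))

  proper : ∀ {u v} → u ~ v → colour u ≢ colour v
  proper {u} {v} u~v eq with ℕₚ.<-cmp (τ u) (τ v)
  ... | tri< u<v _ _ = attached-≢ u<v (~⇒attached u~v u<v) (colour-β eq)
  ... | tri> _ _ v<u = attached-≢ v<u (~⇒attached (~-sym u~v) v<u) (sym (colour-β eq))
  ... | tri≈ _ τ≡ _  = same-bag τ≡ (λ u≡v → ~-irrefl u≡v u~v) (inj₁ u~v) eq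

  two-path : ∀ {w x w′} → w ~ x → x ~ w′ → τ w < τ w′ → τ w ≤ τ x → colour w ≢ colour w′
  two-path {w} {x} {w′} w~x x~w′ w<w′ w≤x eq with τ w′ ℕₚ.≤? τ x
  ... | yes w′≤x = attached-≢ w<w′
          -- Here `x` is not in a bag before that of `w′`, so the bag of `w` is attached to that of
          -- `w′` through `x`.
          (attached-complete (bag (τ w′)) refl (inj₂ (~-sym x~w′)) w′≤x (~-sym w~x) w<w′) (colour-β eq)
  ... | no  w′≰x with ℕₚ.m≤n⇒m<n∨m≡n w≤x
  -- The bag of `w` is attached to that of `x`, and this one to that of `w′`.
  ...   | inj₁ w<x = attached²-≢ w<w′ (~⇒attached w~x w<x) (~⇒attached x~w′ (ℕₚ.≰⇒> w′≰x)) (colour-β eq)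
  ...   | inj₂ w≡x = attached-≢ w<w′
          (subst (_∈ attachedTo (τ w′)) (sym w≡x) (~⇒attached x~w′ (ℕₚ.≰⇒> w′≰x))) (colour-β eq)

  -- Suppose `τ w ≤ τ x`. If `w` and `w′` lie in different bags, `two-path` tells their colours
  -- apart; if in the same bag, they are near each other through `x` and their local colours differ.
  middle-first : ∀ {w x w′} → w ~ x → x ~ w′ → w ≢ w′ → colour w ≡ colour w′ → τ x < τ w
  middle-first {w} {x} {w′} w~x x~w′ w≢w′ eq with τ w ℕₚ.≤? τ x
  ... | no  w≰x = ℕₚ.≰⇒> w≰x
  ... | yes w≤x with ℕₚ.<-cmp (τ w) (τ w′)
  ...   | tri< w<w′ _ _ = contradiction eq (two-path w~x x~w′ w<w′ w≤x)
  ...   | tri≈ _ τ≡ _   = contradiction eq (same-bag τ≡ w≢w′ (inj₂ (x , w≤x , w~x , x~w′)))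
  ...   | tri> _ _ w′<w = contradiction (sym eq)
          (two-path (~-sym x~w′) (~-sym w~x) w′<w (ℕₚ.≤-trans (ℕₚ.<⇒≤ w′<w) w≤x))

  -- The lexicographic order by bag, then by vertex number, as one natural number.
  key : Fin n → ℕ
  key v = τ v * n + toℕ v

  τ<⇒key< : ∀ {u v} → τ u < τ v → key u < key v
  τ<⇒key< {u} {v} u<v = begin-strict
    τ u * n + toℕ u  <⟨ ℕₚ.+-monoʳ-< (τ u * n) (toℕ<n u) ⟩
    τ u * n + n      ≡⟨ ℕₚ.+-comm (τ u * n) n ⟩
    suc (τ u) * n    ≤⟨ ℕₚ.*-monoˡ-≤ n u<v ⟩
    τ v * n          ≤⟨ ℕₚ.m≤m+n (τ v * n) (toℕ v) ⟩
    τ v * n + toℕ v  ∎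
    where open ℕₚ.≤-Reasoning

  key-injective : ∀ {u v} → key u ≡ key v → u ≡ v
  key-injective {u} {v} eq with ℕₚ.<-cmp (τ u) (τ v)
  ... | tri< u<v _ _ = contradiction eq (ℕₚ.<⇒≢ (τ<⇒key< u<v))
  ... | tri> _ _ v<u = contradiction (sym eq) (ℕₚ.<⇒≢ (τ<⇒key< v<u))
  ... | tri≈ _ τ≡ _  = toℕ-injective (ℕₚ.+-cancelˡ-≡ (τ u * n) _ _
          (trans eq (cong (λ j → j * n + toℕ v) (sym τ≡))))

  starColouring : StarColouring G (colours h)
  starColouring = record
    { colour        = colour
    ; key           = key
    ; key-injective = key-injective
    ; proper        = proper
    ; centre        = λ w~x x~w′ w≢w′ eq → τ<⇒key< (middle-first w~x x~w′ w≢w′ eq)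
    }

-- Excluded minors bound the boxicity

minor-or-boxes : ∀ {h n} (H : Graph h) (G : Graph n) →
  H IsMinorOf G ⊎ BoxRepresentation G (colours h * colours h)
minor-or-boxes H G with BagPartition.partition H G
... | inj₁ minor               = inj₁ minor
... | inj₂ (τ , m , τ<m , bag) = inj₂ (StarIntervals.starBoxes G (Colouring.starColouring H G τ m τ<m bag))

theorem11 : ∀ {h : ℕ} (H : Graph h) → Planar H →
    ∃[ c ] (∀ {n : ℕ} (G : Graph n) (b : ℕ) → IsBoxicity G b → c ≤ b → H IsMinorOf G)
-- The constant is one more than the number of coordinates, so the second alternative contradicts
-- the minimality of `b`.
theorem11 {h} H _ = suc (colours h * colours h) , λ G b (_ , minimal) c≤b →
  [ (λ minor → minor)
  , (λ boxes → contradiction (minimal _ boxes) (ℕₚ.<⇒≱ c≤b))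
  ]′ (minor-or-boxes H G)
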